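{- For $n\ge 1$, let $b_n(\lambda)$ be the characteristic polynomial of the $n\times n$ matrix $B_n$ whose $(p,q)$ entry is $2^{q-p-1}$ if $q>p$, $0$ if $q=p$, $1$ if $q=p-1$, and $0$ if $q<p-1$; and let $b_0(\lambda)=1$. Then for all $n\ge 1$, $$b_{n}(\lambda) = -\lambda b_{n-1}(\lambda)-\frac{1}{4}\sum_{i=2}^{n}(-2)^{i}b_{n-i}(\lambda).$$
   Context: The characteristic polynomial of an $n\times n$ matrix $B_n$ is $\det(B_n-\lambda I)$. Empty sums are $0$. -}

module Defs where

open import Algebra.Bundles.Raw using (RawRing)
open import Data.Bool.Base using (if_then_else_)
open import Data.Fin.Base using (Fin; zero; suc; toℕ; punchIn)
import Data.Fin.Properties as Fin
import Data.Integer.Base as ℤ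
open import Data.List.Base using (List; []; _∷_; map)
open import Data.Nat.Base as ℕ using (ℕ; zero; suc; _∸_)
import Data.Nat.Properties as ℕₚ
open import Data.Rational.Base as ℚ using (ℚ; 0ℚ; 1ℚ)
open import Level using (0ℓ)
open import Relation.Nullary.Decidable using (does)

import Algebra.Definitions.RawSemiring as RawSemiringDefs

Matrix : ∀ {a} → Set a → ℕ → Set a
Matrix A n = Fin n → Fin n → A

module Determinant {c ℓ} (R : RawRing c ℓ) where
  open RawRing R
  open RawSemiringDefs rawSemiring using (sum; _^_)

  minor : ∀ {n} → Matrix Carrier (suc n) → Fin (suc n) → Fin (suc n) → Matrix Carrier n
  minor A p q i j = A (punchIn p i) (punchIn q j)

  -- Laplace expansion along the first row.
  det : ∀ {n} → Matrix Carrier n → Carrier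
  det {zero}  A = 1#
  det {suc n} A = sum λ q → ((- 1#) ^ toℕ q) * (A zero q * det (minor A zero q))

-- Polynomials in one variable, as lists of coefficients with the constant
-- term first. Trailing zeros are allowed, so equality is coefficientwise.
module Polynomial {c ℓ} (R : RawRing c ℓ) where
  private module R = RawRing R

  Poly : Set c
  Poly = List R.Carrier

  coeff : Poly → ℕ → R.Carrier
  coeff []      k       = R.0#
  coeff (a ∷ f) zero    = a
  coeff (a ∷ f) (suc k) = coeff f k

  _≈ₚ_ : Poly → Poly → Set ℓ
  f ≈ₚ g = ∀ k → coeff f k R.≈ coeff g k

  _+ₚ_ : Poly → Poly → Poly
  []      +ₚ g       = g
  (a ∷ f) +ₚ []      = a ∷ f
  (a ∷ f) +ₚ (b ∷ g) = (a R.+ b) ∷ (f +ₚ g)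

  -- (a + λ f) g = a g + λ (f g)
  _*ₚ_ : Poly → Poly → Poly
  []      *ₚ g = []
  (a ∷ f) *ₚ g = map (a R.*_) g +ₚ (R.0# ∷ (f *ₚ g))

  polyRing : RawRing c ℓ
  polyRing = record
    { Carrier = Poly
    ; _≈_     = _≈ₚ_
    ; _+_     = _+ₚ_
    ; _*_     = _*ₚ_
    ; -_      = map (λ a → R.- a)
    ; 0#      = []
    ; 1#      = R.1# ∷ []
    }

  const : R.Carrier → Poly
  const a = a ∷ []

  indeterminate : Poly
  indeterminate = R.0# ∷ R.1# ∷ []

module CharacteristicPolynomial {c ℓ} (R : RawRing c ℓ) where
  open Polynomial R
  open RawRing polyRing
  open Determinant polyRing

  identity : ∀ {n} → Matrix Carrier n
  identity p q = if does (p Fin.≟ q) then 1# else 0#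

  charPoly : ∀ {n} → Matrix (RawRing.Carrier R) n → Carrier
  charPoly A = det λ p q → const (A p q) + (- (indeterminate * identity p q))

open RawSemiringDefs ℚ.+-*-rawSemiring public using () renaming (_^_ to _^ℚ_)

2ℚ -2ℚ ¼ : ℚ
2ℚ  = ℤ.+ 2 ℚ./ 1
-2ℚ = ℚ.- 2ℚ
¼   = ℤ.+ 1 ℚ./ 4

ℚ[λ] : RawRing 0ℓ 0ℓ
ℚ[λ] = Polynomial.polyRing ℚ.+-*-rawRing

open RawRing ℚ[λ] public using (Carrier; _≈_; _+_; _*_; -_; 0#; 1#)
open Polynomial ℚ.+-*-rawRing public using (const)
open CharacteristicPolynomial ℚ.+-*-rawRing public using (charPoly)

Λ : Carrier
Λ = Polynomial.indeterminate ℚ.+-*-rawRing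

infixl 6 _-_
_-_ : Carrier → Carrier → Carrier
f - g = f + (- g)

-- Sum over m ≤ i ≤ n; it has (n + 1) ∸ m terms, hence none when n < m.
∑⟨_⋯_⟩ : ℕ → ℕ → (ℕ → Carrier) → Carrier
∑⟨ m ⋯ n ⟩ f = sum {suc n ∸ m} λ k → f (m ℕ.+ toℕ k)
  where open RawSemiringDefs (RawRing.rawSemiring ℚ[λ]) using (sum)

-- Rows and columns are numbered from 0 rather than 1; the entries depend only
-- on q - p. The two zero cases, q = p and q < p - 1, are merged.
B : ∀ n → Matrix ℚ n
B n p q =
  if does (toℕ p ℕₚ.<? toℕ q) then 2ℚ ^ℚ (toℕ q ∸ toℕ p ∸ 1) else
  if does (suc (toℕ q) ℕₚ.≟ toℕ p) then 1ℚ else 0ℚ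

b : ℕ → Carrier
b zero    = 1#
b (suc n) = charPoly (B (suc n))

-- Expand det (B_n - λI) along the first row. Deleting row 0 and column q from an
-- upper Hessenberg Toeplitz matrix with subdiagonal 1 leaves a block upper
-- triangular matrix: a unitriangular q × q block followed by the matrix of the
-- same shape of size n - 1 - q. Hence the cofactors are (-1)^q b_{n-1-q}, and
-- the claim reduces to (-1)^(k+1) 2^k = -¼ (-2)^(k+2).
module Submission where

open import Defs using (Matrix; module Polynomial; module Determinant)
open import Data.Nat.Base using (ℕ; _≥_; _∸_)

open import Algebra.Bundles using (Ring; CommutativeRing)
open import Algebra.Bundles.Raw using (RawRing)
import Algebra.Definitions.RawSemiring as RawSemiringDefs
import Algebra.Properties.CommutativeSemigroup as CommutativeSemigroupProperties
import Algebra.Properties.CommutativeSemiring.Exp as Exp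
import Algebra.Properties.Ring as RingProperties
import Algebra.Properties.Semiring.Sum as SemiringSum
open import Algebra.Structures using (IsRing)
open import Data.Fin.Base using (Fin; zero; suc; toℕ; punchIn)
open import Data.List.Base using ([]; _∷_; map)
open import Data.Nat.Base as ℕ using (zero; suc)
open import Data.Product.Base using (_,_)
open import Data.Rational.Base as ℚ using (1ℚ)
import Data.Rational.Properties as ℚₚ
import Relation.Binary.PropositionalEquality as ≡
open import Relation.Binary.PropositionalEquality using (_≡_)
import Relation.Binary.Reasoning.Setoid as SetoidReasoning

-- Coefficient-list polynomials over a ring form a ring.

module PolynomialRing {c ℓ} (R : Ring c ℓ) where
  open Ring R hiding (zero)
  open Polynomial rawRing renaming (const to constant)
  open CommutativeSemigroupProperties +-commutativeSemigroup using (interchange)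
  open RingProperties R using (-0#≈0#)
  open SetoidReasoning setoid

  coeff-+ : ∀ f g k → coeff (f +ₚ g) k ≈ coeff f k + coeff g k
  coeff-+ []      g       k       = sym (+-identityˡ _)
  coeff-+ (a ∷ f) []      k       = sym (+-identityʳ _)
  coeff-+ (a ∷ f) (b ∷ g) zero    = refl
  coeff-+ (a ∷ f) (b ∷ g) (suc k) = coeff-+ f g k

  coeff-neg : ∀ f k → coeff (map (-_) f) k ≈ - coeff f k
  coeff-neg []      k       = sym -0#≈0#
  coeff-neg (a ∷ f) zero    = refl
  coeff-neg (a ∷ f) (suc k) = coeff-neg f k

  coeff-scale : ∀ a f k → coeff (map (a *_) f) k ≈ a * coeff f k
  coeff-scale a []      k       = sym (zeroʳ a)
  coeff-scale a (b ∷ f) zero    = refl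
  coeff-scale a (b ∷ f) (suc k) = coeff-scale a f k

  -- The recursion of `*ₚ` read at one coefficient. The shifted summand is left unsplit, so the
  -- inductions on the left factor below can treat all `k` uniformly.
  coeff-∷* : ∀ a f g k →
             coeff ((a ∷ f) *ₚ g) k ≈ a * coeff g k + coeff (0# ∷ (f *ₚ g)) k
  coeff-∷* a f g k =
    trans (coeff-+ (map (a *_) g) (0# ∷ (f *ₚ g)) k) (+-congʳ (coeff-scale a g k))

  -- f ≈ₚ g unfolds to a function type from which f and g cannot be inferred, so
  -- the congruence lemmas take them explicitly.
  shift-cong : ∀ f g → f ≈ₚ g → (0# ∷ f) ≈ₚ (0# ∷ g)
  shift-cong f g f≈g zero    = refl
  shift-cong f g f≈g (suc k) = f≈g k

  shift-zero : ∀ f → f ≈ₚ [] → (0# ∷ f) ≈ₚ []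
  shift-zero f f≈0 zero    = refl
  shift-zero f f≈0 (suc k) = f≈0 k

  coeff-shift-+ : ∀ f g k →
                  coeff (0# ∷ (f +ₚ g)) k ≈ coeff (0# ∷ f) k + coeff (0# ∷ g) k
  coeff-shift-+ f g zero    = sym (+-identityˡ 0#)
  coeff-shift-+ f g (suc k) = coeff-+ f g k

  coeff-shift-scale : ∀ a f k → coeff (0# ∷ map (a *_) f) k ≈ a * coeff (0# ∷ f) k
  coeff-shift-scale a f zero    = sym (zeroʳ a)
  coeff-shift-scale a f (suc k) = coeff-scale a f k

  +ₚ-cong : ∀ f f′ g g′ → f ≈ₚ f′ → g ≈ₚ g′ → (f +ₚ g) ≈ₚ (f′ +ₚ g′)
  +ₚ-cong f f′ g g′ f≈f′ g≈g′ k = begin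
    coeff (f +ₚ g) k          ≈⟨ coeff-+ f g k ⟩
    coeff f k + coeff g k     ≈⟨ +-cong (f≈f′ k) (g≈g′ k) ⟩
    coeff f′ k + coeff g′ k   ≈⟨ coeff-+ f′ g′ k ⟨
    coeff (f′ +ₚ g′) k        ∎

  +ₚ-assoc : ∀ f g h → ((f +ₚ g) +ₚ h) ≈ₚ (f +ₚ (g +ₚ h))
  +ₚ-assoc f g h k = begin
    coeff ((f +ₚ g) +ₚ h) k               ≈⟨ coeff-+ (f +ₚ g) h k ⟩
    coeff (f +ₚ g) k + coeff h k          ≈⟨ +-congʳ (coeff-+ f g k) ⟩
    (coeff f k + coeff g k) + coeff h k   ≈⟨ +-assoc _ _ _ ⟩
    coeff f k + (coeff g k + coeff h k)   ≈⟨ +-congˡ (coeff-+ g h k) ⟨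
    coeff f k + coeff (g +ₚ h) k          ≈⟨ coeff-+ f (g +ₚ h) k ⟨
    coeff (f +ₚ (g +ₚ h)) k               ∎

  +ₚ-comm : ∀ f g → (f +ₚ g) ≈ₚ (g +ₚ f)
  +ₚ-comm f g k = begin
    coeff (f +ₚ g) k        ≈⟨ coeff-+ f g k ⟩
    coeff f k + coeff g k   ≈⟨ +-comm _ _ ⟩
    coeff g k + coeff f k   ≈⟨ coeff-+ g f k ⟨
    coeff (g +ₚ f) k        ∎

  +ₚ-identityʳ : ∀ f → (f +ₚ []) ≈ₚ f
  +ₚ-identityʳ f k = trans (coeff-+ f [] k) (+-identityʳ _)

  +ₚ-inverseʳ : ∀ f → (f +ₚ map (-_) f) ≈ₚ []
  +ₚ-inverseʳ f k = begin
    coeff (f +ₚ map (-_) f) k          ≈⟨ coeff-+ f (map (-_) f) k ⟩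
    coeff f k + coeff (map (-_) f) k   ≈⟨ +-congˡ (coeff-neg f k) ⟩
    coeff f k + - coeff f k            ≈⟨ -‿inverseʳ _ ⟩
    0#                                 ∎

  +ₚ-inverseˡ : ∀ f → (map (-_) f +ₚ f) ≈ₚ []
  +ₚ-inverseˡ f k = trans (+ₚ-comm (map (-_) f) f k) (+ₚ-inverseʳ f k)

  neg-cong : ∀ f g → f ≈ₚ g → map (-_) f ≈ₚ map (-_) g
  neg-cong f g f≈g k = begin
    coeff (map (-_) f) k   ≈⟨ coeff-neg f k ⟩
    - coeff f k            ≈⟨ -‿cong (f≈g k) ⟩
    - coeff g k            ≈⟨ coeff-neg g k ⟨
    coeff (map (-_) g) k   ∎

  -- A list equal to zero may still be a nonempty list of zeros. This covers that case when
  -- congruence compares left factors of different lengths.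
  ≈[]⇒*ₚ≈[] : ∀ f g → f ≈ₚ [] → (f *ₚ g) ≈ₚ []
  ≈[]⇒*ₚ≈[] []      g f≈0 k = refl
  ≈[]⇒*ₚ≈[] (a ∷ f) g f≈0 k = begin
    coeff ((a ∷ f) *ₚ g) k                   ≈⟨ coeff-∷* a f g k ⟩
    a * coeff g k + coeff (0# ∷ (f *ₚ g)) k  ≈⟨ +-cong (*-congʳ (f≈0 zero))
                                                  (shift-zero (f *ₚ g) (≈[]⇒*ₚ≈[] f g λ j → f≈0 (suc j)) k) ⟩
    0# * coeff g k + 0#                      ≈⟨ +-identityʳ _ ⟩
    0# * coeff g k                           ≈⟨ zeroˡ _ ⟩
    0#                                       ∎

  *ₚ-congʳ : ∀ f f′ g → f ≈ₚ f′ → (f *ₚ g) ≈ₚ (f′ *ₚ g)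
  -- When one list runs out first, what remains of the other has only zero coefficients.
  *ₚ-congʳ []      f′       g f≈f′ k = sym (≈[]⇒*ₚ≈[] f′ g (λ j → sym (f≈f′ j)) k)
  *ₚ-congʳ (a ∷ f) []       g f≈f′ k = ≈[]⇒*ₚ≈[] (a ∷ f) g f≈f′ k
  *ₚ-congʳ (a ∷ f) (b ∷ f′) g f≈f′ k = begin
    coeff ((a ∷ f) *ₚ g) k                    ≈⟨ coeff-∷* a f g k ⟩
    a * coeff g k + coeff (0# ∷ (f *ₚ g)) k   ≈⟨ +-cong (*-congʳ (f≈f′ zero))
                                                   (shift-cong (f *ₚ g) (f′ *ₚ g) (*ₚ-congʳ f f′ g λ j → f≈f′ (suc j)) k) ⟩
    b * coeff g k + coeff (0# ∷ (f′ *ₚ g)) k  ≈⟨ coeff-∷* b f′ g k ⟨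
    coeff ((b ∷ f′) *ₚ g) k                   ∎

  *ₚ-congˡ : ∀ f g g′ → g ≈ₚ g′ → (f *ₚ g) ≈ₚ (f *ₚ g′)
  *ₚ-congˡ []      g g′ g≈g′ k = refl
  *ₚ-congˡ (a ∷ f) g g′ g≈g′ k = begin
    coeff ((a ∷ f) *ₚ g) k                     ≈⟨ coeff-∷* a f g k ⟩
    a * coeff g k + coeff (0# ∷ (f *ₚ g)) k    ≈⟨ +-cong (*-congˡ (g≈g′ k))
                                                    (shift-cong (f *ₚ g) (f *ₚ g′) (*ₚ-congˡ f g g′ g≈g′) k) ⟩
    a * coeff g′ k + coeff (0# ∷ (f *ₚ g′)) k  ≈⟨ coeff-∷* a f g′ k ⟨
    coeff ((a ∷ f) *ₚ g′) k                    ∎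

  *ₚ-distribˡ : ∀ f g h → (f *ₚ (g +ₚ h)) ≈ₚ ((f *ₚ g) +ₚ (f *ₚ h))
  *ₚ-distribˡ []      g h k = refl
  *ₚ-distribˡ (a ∷ f) g h k = begin
    coeff ((a ∷ f) *ₚ (g +ₚ h)) k
      ≈⟨ coeff-∷* a f (g +ₚ h) k ⟩
    a * coeff (g +ₚ h) k + coeff (0# ∷ (f *ₚ (g +ₚ h))) k
      ≈⟨ +-cong (trans (*-congˡ (coeff-+ g h k)) (distribˡ a _ _))
           (trans (shift-cong (f *ₚ (g +ₚ h)) ((f *ₚ g) +ₚ (f *ₚ h)) (*ₚ-distribˡ f g h) k)
                  (coeff-shift-+ (f *ₚ g) (f *ₚ h) k)) ⟩
    (a * coeff g k + a * coeff h k) + (coeff (0# ∷ (f *ₚ g)) k + coeff (0# ∷ (f *ₚ h)) k)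
      ≈⟨ interchange _ _ _ _ ⟩
    (a * coeff g k + coeff (0# ∷ (f *ₚ g)) k) + (a * coeff h k + coeff (0# ∷ (f *ₚ h)) k)
      ≈⟨ +-cong (coeff-∷* a f g k) (coeff-∷* a f h k) ⟨
    coeff ((a ∷ f) *ₚ g) k + coeff ((a ∷ f) *ₚ h) k
      ≈⟨ coeff-+ ((a ∷ f) *ₚ g) ((a ∷ f) *ₚ h) k ⟨
    coeff (((a ∷ f) *ₚ g) +ₚ ((a ∷ f) *ₚ h)) k ∎

  -- Multiplication may be noncommutative, so this cannot be read off from `*ₚ-distribˡ` and takes
  -- its own induction.
  *ₚ-distribʳ : ∀ h f g → ((f +ₚ g) *ₚ h) ≈ₚ ((f *ₚ h) +ₚ (g *ₚ h))
  *ₚ-distribʳ h []      g       k = refl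
  *ₚ-distribʳ h (a ∷ f) []      k = sym (+ₚ-identityʳ ((a ∷ f) *ₚ h) k)
  *ₚ-distribʳ h (a ∷ f) (b ∷ g) k = begin
    coeff (((a + b) ∷ (f +ₚ g)) *ₚ h) k
      ≈⟨ coeff-∷* (a + b) (f +ₚ g) h k ⟩
    (a + b) * coeff h k + coeff (0# ∷ ((f +ₚ g) *ₚ h)) k
      ≈⟨ +-cong (distribʳ _ a b)
           (trans (shift-cong ((f +ₚ g) *ₚ h) ((f *ₚ h) +ₚ (g *ₚ h)) (*ₚ-distribʳ h f g) k)
                  (coeff-shift-+ (f *ₚ h) (g *ₚ h) k)) ⟩
    (a * coeff h k + b * coeff h k) + (coeff (0# ∷ (f *ₚ h)) k + coeff (0# ∷ (g *ₚ h)) k)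
      ≈⟨ interchange _ _ _ _ ⟩
    (a * coeff h k + coeff (0# ∷ (f *ₚ h)) k) + (b * coeff h k + coeff (0# ∷ (g *ₚ h)) k)
      ≈⟨ +-cong (coeff-∷* a f h k) (coeff-∷* b g h k) ⟨
    coeff ((a ∷ f) *ₚ h) k + coeff ((b ∷ g) *ₚ h) k
      ≈⟨ coeff-+ ((a ∷ f) *ₚ h) ((b ∷ g) *ₚ h) k ⟨
    coeff (((a ∷ f) *ₚ h) +ₚ ((b ∷ g) *ₚ h)) k ∎

  scale-*ₚ : ∀ a f g → (map (a *_) f *ₚ g) ≈ₚ map (a *_) (f *ₚ g)
  scale-*ₚ a []      g k = refl
  scale-*ₚ a (b ∷ f) g k = begin
    coeff ((a * b ∷ map (a *_) f) *ₚ g) k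
      ≈⟨ coeff-∷* (a * b) (map (a *_) f) g k ⟩
    a * b * coeff g k + coeff (0# ∷ (map (a *_) f *ₚ g)) k
      ≈⟨ +-cong (*-assoc a b _)
           (trans (shift-cong (map (a *_) f *ₚ g) (map (a *_) (f *ₚ g)) (scale-*ₚ a f g) k)
                  (coeff-shift-scale a (f *ₚ g) k)) ⟩
    a * (b * coeff g k) + a * coeff (0# ∷ (f *ₚ g)) k
      ≈⟨ distribˡ a _ _ ⟨
    a * (b * coeff g k + coeff (0# ∷ (f *ₚ g)) k)
      ≈⟨ *-congˡ (coeff-∷* b f g k) ⟨
    a * coeff ((b ∷ f) *ₚ g) k
      ≈⟨ coeff-scale a ((b ∷ f) *ₚ g) k ⟨
    coeff (map (a *_) ((b ∷ f) *ₚ g)) k ∎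

  shift-*ₚ : ∀ f g → ((0# ∷ f) *ₚ g) ≈ₚ (0# ∷ (f *ₚ g))
  shift-*ₚ f g k = begin
    coeff ((0# ∷ f) *ₚ g) k                    ≈⟨ coeff-∷* 0# f g k ⟩
    0# * coeff g k + coeff (0# ∷ (f *ₚ g)) k   ≈⟨ +-congʳ (zeroˡ _) ⟩
    0# + coeff (0# ∷ (f *ₚ g)) k               ≈⟨ +-identityˡ _ ⟩
    coeff (0# ∷ (f *ₚ g)) k                    ∎

  -- Induction on the first factor: `*ₚ-distribʳ` splits `(a ∷ f) *ₚ g` into a scaled and a shifted
  -- part, and `scale-*ₚ` and `shift-*ₚ` move the scalar and the shift past `h`.
  *ₚ-assoc : ∀ f g h → ((f *ₚ g) *ₚ h) ≈ₚ (f *ₚ (g *ₚ h))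
  *ₚ-assoc []      g h k = refl
  *ₚ-assoc (a ∷ f) g h k = begin
    coeff ((map (a *_) g +ₚ (0# ∷ (f *ₚ g))) *ₚ h) k
      ≈⟨ *ₚ-distribʳ h (map (a *_) g) (0# ∷ (f *ₚ g)) k ⟩
    coeff ((map (a *_) g *ₚ h) +ₚ ((0# ∷ (f *ₚ g)) *ₚ h)) k
      ≈⟨ coeff-+ (map (a *_) g *ₚ h) ((0# ∷ (f *ₚ g)) *ₚ h) k ⟩
    coeff (map (a *_) g *ₚ h) k + coeff ((0# ∷ (f *ₚ g)) *ₚ h) k
      ≈⟨ +-cong (trans (scale-*ₚ a g h k) (coeff-scale a (g *ₚ h) k))
           (trans (shift-*ₚ (f *ₚ g) h k)
                  (shift-cong ((f *ₚ g) *ₚ h) (f *ₚ (g *ₚ h)) (*ₚ-assoc f g h) k)) ⟩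
    a * coeff (g *ₚ h) k + coeff (0# ∷ (f *ₚ (g *ₚ h))) k
      ≈⟨ coeff-∷* a f (g *ₚ h) k ⟨
    coeff ((a ∷ f) *ₚ (g *ₚ h)) k ∎

  constant-*ₚ : ∀ a g k → coeff (constant a *ₚ g) k ≈ a * coeff g k
  constant-*ₚ a g k = begin
    coeff (constant a *ₚ g) k              ≈⟨ coeff-∷* a [] g k ⟩
    a * coeff g k + coeff (0# ∷ []) k      ≈⟨ +-congˡ (shift-zero [] (λ _ → refl) k) ⟩
    a * coeff g k + 0#                     ≈⟨ +-identityʳ _ ⟩
    a * coeff g k                          ∎

  *ₚ-identityˡ : ∀ f → (constant 1# *ₚ f) ≈ₚ f
  *ₚ-identityˡ f k = trans (constant-*ₚ 1# f k) (*-identityˡ _)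

  *ₚ-identityʳ : ∀ f → (f *ₚ constant 1#) ≈ₚ f
  *ₚ-identityʳ []      k       = refl
  -- The product computes to `(a * 1# + 0#) ∷ (f *ₚ constant 1#)`.
  *ₚ-identityʳ (a ∷ f) zero    = trans (+-identityʳ _) (*-identityʳ a)
  *ₚ-identityʳ (a ∷ f) (suc k) = *ₚ-identityʳ f k

  constant-homo-* : ∀ a b → (constant a *ₚ constant b) ≈ₚ constant (a * b)
  constant-homo-* a b k = trans (constant-*ₚ a (constant b) k) (sym (coeff-scale a (constant b) k))

  polynomial-isRing : IsRing _≈ₚ_ _+ₚ_ _*ₚ_ (map (-_)) [] (constant 1#)
  polynomial-isRing = record
    { +-isAbelianGroup = record
      { isGroup = record
        { isMonoid = record
          { isSemigroup = record
            { isMagma = record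
              { isEquivalence = record
                { refl  = λ k → refl
                ; sym   = λ f≈g k → sym (f≈g k)
                ; trans = λ f≈g g≈h k → trans (f≈g k) (g≈h k)
                }
              ; ∙-cong = λ {f} {f′} {g} {g′} → +ₚ-cong f f′ g g′
              }
            ; assoc = +ₚ-assoc
            }
          ; identity = (λ f k → refl) , +ₚ-identityʳ
          }
        ; inverse = +ₚ-inverseˡ , +ₚ-inverseʳ
        ; ⁻¹-cong = λ {f} {g} → neg-cong f g
        }
      ; comm = +ₚ-comm
      }
    ; *-cong     = λ {f} {f′} {g} {g′} f≈f′ g≈g′ k →
                     trans (*ₚ-congʳ f f′ g f≈f′ k) (*ₚ-congˡ f′ g g′ g≈g′ k)
    ; *-assoc    = *ₚ-assoc
    ; *-identity = *ₚ-identityˡ , *ₚ-identityʳ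
    ; distrib    = *ₚ-distribˡ , *ₚ-distribʳ
    }

  polynomialRing : Ring c ℓ
  polynomialRing = record { isRing = polynomial-isRing }

-- Determinants by first-row expansion, and unit Hessenberg Toeplitz families.

module DeterminantProperties {c ℓ} (R : Ring c ℓ) where
  open Ring R hiding (zero)
  open Determinant rawRing
  open RawSemiringDefs (RawRing.rawSemiring rawRing) using (_^_)
  open SemiringSum semiring using (sum; sum-cong-≋; sum-replicate-zero; *-distribˡ-sum)
  open RingProperties R using (-‿distribˡ-*)
  open SetoidReasoning setoid

  sum-zero : ∀ {n} (t : Fin n → Carrier) → (∀ i → t i ≈ 0#) → sum t ≈ 0#
  sum-zero {n} t t≈0 = trans (sum-cong-≋ t≈0) (sum-replicate-zero n)

  det-cong : ∀ {n} {M N : Matrix Carrier n} → (∀ i j → M i j ≈ N i j) → det M ≈ det N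
  det-cong {zero}  M≈N = refl
  det-cong {suc n} M≈N = sum-cong-≋ λ q →
    *-congˡ {x = (- 1#) ^ toℕ q} (*-cong (M≈N zero q) (det-cong λ i j → M≈N (suc i) (punchIn q j)))

  cofactorTerm-zero : ∀ s a d → d ≈ 0# → s * (a * d) ≈ 0#
  cofactorTerm-zero s a d d≈0 =
    trans (*-congˡ (trans (*-congˡ d≈0) (zeroʳ a))) (zeroʳ s)

  -- In the first-row expansion the leading term contains the zero entry itself. Every other minor
  -- keeps column 0 in front, since `punchIn (suc q) zero` is `zero`, and vanishes by induction.
  det-zeroColumn : ∀ {n} (M : Matrix Carrier (suc n)) → (∀ i → M i zero ≈ 0#) → det M ≈ 0#
  det-zeroColumn {n} M col≈0 = sum-zero _ (term n M col≈0)
    where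
    term : ∀ n (M : Matrix Carrier (suc n)) → (∀ i → M i zero ≈ 0#) → ∀ q →
           (- 1#) ^ toℕ q * (M zero q * det (minor M zero q)) ≈ 0#
    term n       M col≈0 zero    = begin
      1# * (M zero zero * det (minor M zero zero))  ≈⟨ *-identityˡ _ ⟩
      M zero zero * det (minor M zero zero)         ≈⟨ *-congʳ (col≈0 zero) ⟩
      0# * det (minor M zero zero)                  ≈⟨ zeroˡ _ ⟩
      0#                                            ∎
    term (suc n) M col≈0 (suc q) = cofactorTerm-zero _ _ _
      (det-zeroColumn (minor M zero (suc q)) λ i → col≈0 (suc i))

  -- Deleting row 0 and a column other than 0 leaves a minor whose first column is zero, so only the
  -- leading cofactor survives.
  det-pivotColumn : ∀ {n} (M : Matrix Carrier (suc n)) → (∀ i → M (suc i) zero ≈ 0#) →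
                    det M ≈ M zero zero * det (minor M zero zero)
  det-pivotColumn {n} M col≈0 = begin
    det M                                              ≈⟨ +-congˡ (sum-zero _ (term n M col≈0)) ⟩
    1# * (M zero zero * det (minor M zero zero)) + 0#  ≈⟨ +-identityʳ _ ⟩
    1# * (M zero zero * det (minor M zero zero))       ≈⟨ *-identityˡ _ ⟩
    M zero zero * det (minor M zero zero)              ∎
    where
    term : ∀ n (M : Matrix Carrier (suc n)) → (∀ i → M (suc i) zero ≈ 0#) → ∀ q →
           (- 1#) ^ suc (toℕ q) * (M zero (suc q) * det (minor M zero (suc q))) ≈ 0#
    term (suc n) M col≈0 q = cofactorTerm-zero _ _ _
      (det-zeroColumn (minor M zero (suc q)) col≈0)

  -- `toeplitz` relates consecutive sizes: deleting the first row and column of `T (suc n)` gives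
  -- `T n`. It therefore suffices to prescribe column 0 below the diagonal; `toeplitz` carries these
  -- values along the other diagonals.
  record IsUnitHessenbergToeplitz (T : ∀ n → Matrix Carrier n) : Set ℓ where
    field
      toeplitz    : ∀ n i j → T (suc n) (suc i) (suc j) ≈ T n i j
      subdiagonal : ∀ n → T (suc (suc n)) (suc zero) zero ≈ 1#
      hessenberg  : ∀ n i → T (suc (suc n)) (suc (suc i)) zero ≈ 0#

  module _ {T : ∀ n → Matrix Carrier n} (isUHT : IsUnitHessenbergToeplitz T) where
    open IsUnitHessenbergToeplitz isUHT

    -- The unitriangular block is peeled off one column at a time. For `suc q` the first column of
    -- the minor is 1 followed by zeros; removing it as a pivot leaves, by `toeplitz`, the minor for
    -- `q` one size down.
    det-minor-zero : ∀ n q → det (minor (T (suc n)) zero q) ≈ det (T (n ∸ toℕ q))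
    det-minor-zero n       zero    = det-cong (toeplitz n)
    det-minor-zero (suc n) (suc q) = begin
      det M                                  ≈⟨ det-pivotColumn M (hessenberg n) ⟩
      M zero zero * det (minor M zero zero)  ≈⟨ *-cong (subdiagonal n) (det-cong λ i j → toeplitz (suc n) (suc i) (punchIn q j)) ⟩
      1# * det (minor (T (suc n)) zero q)    ≈⟨ *-identityˡ _ ⟩
      det (minor (T (suc n)) zero q)         ≈⟨ det-minor-zero n q ⟩
      det (T (n ∸ toℕ q))                    ∎
      where
      M : Matrix Carrier (suc n)
      M = minor (T (suc (suc n))) zero (suc q)

    det-expansion : ∀ n → det (T (suc n)) ≈
      sum λ q → (- 1#) ^ toℕ q * (T (suc n) zero q * det (T (n ∸ toℕ q)))
    det-expansion n = sum-cong-≋ λ q →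
      *-congˡ {x = (- 1#) ^ toℕ q} (*-congˡ {x = T (suc n) zero q} (det-minor-zero n q))

    -- The last hypothesis absorbs the cofactor sign into the first-row entry and isolates a common
    -- left factor `- c`, which then comes out of the sum. Index `q` stands for column `suc q`.
    det-recurrence : ∀ n x c (e : ℕ → Carrier) → T (suc n) zero zero ≈ x →
      (∀ (q : Fin n) → (- 1#) ^ suc (toℕ q) * T (suc n) zero (suc q) ≈ - c * e (toℕ q)) →
      det (T (suc n)) ≈
        x * det (T n) - c * sum {n} λ q → e (toℕ q) * det (T (n ∸ suc (toℕ q)))
    det-recurrence n x c e T₀₀≈x T₀q≈ce = begin
      det (T (suc n))
        ≈⟨ det-expansion n ⟩
      -- The sum over `Fin (suc n)` computes to its first term plus the rest, with sign
      -- `(- 1#) ^ zero`, that is `1#`, on the first term.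
      1# * (T (suc n) zero zero * det (T n)) +
        sum {n} (λ q → (- 1#) ^ suc (toℕ q) * (T (suc n) zero (suc q) * d q))
        ≈⟨ +-cong (trans (*-identityˡ _) (*-congʳ T₀₀≈x)) (sum-cong-≋ term) ⟩
      x * det (T n) + sum (λ q → - c * (e (toℕ q) * d q))
        ≈⟨ +-congˡ (*-distribˡ-sum (- c) (λ q → e (toℕ q) * d q)) ⟨
      x * det (T n) + - c * sum (λ q → e (toℕ q) * d q)
        ≈⟨ +-congˡ (-‿distribˡ-* c _) ⟨
      x * det (T n) - c * sum (λ q → e (toℕ q) * d q) ∎
      where
      d : Fin n → Carrier
      d q = det (T (n ∸ suc (toℕ q)))

      term : ∀ q → (- 1#) ^ suc (toℕ q) * (T (suc n) zero (suc q) * d q) ≈ - c * (e (toℕ q) * d q)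
      term q = begin
        (- 1#) ^ suc (toℕ q) * (T (suc n) zero (suc q) * d q)  ≈⟨ *-assoc _ _ _ ⟨
        (- 1#) ^ suc (toℕ q) * T (suc n) zero (suc q) * d q    ≈⟨ *-congʳ (T₀q≈ce q) ⟩
        - c * e (toℕ q) * d q                                  ≈⟨ *-assoc _ _ _ ⟩
        - c * (e (toℕ q) * d q)                                ∎

-- The family `B n - λI` and its recurrence.

open import Defs

module ℚRing = CommutativeRing ℚₚ.+-*-commutativeRing

open PolynomialRing ℚRing.ring
open DeterminantProperties polynomialRing
open RawSemiringDefs (RawRing.rawSemiring ℚ[λ]) using (_^_)
open SetoidReasoning (Ring.setoid polynomialRing)

const-^ : ∀ x k → const x ^ k ≈ const (x ^ℚ k)
const-^ x zero    = λ _ → ≡.refl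
const-^ x (suc k) = begin
  const x * const x ^ k        ≈⟨ *ₚ-congˡ (const x) (const x ^ k) (const (x ^ℚ k)) (const-^ x k) ⟩
  const x * const (x ^ℚ k)     ≈⟨ constant-homo-* x (x ^ℚ k) ⟩
  const (x ^ℚ suc k)           ∎

B-λI : ∀ n → Matrix Carrier n
B-λI n p q = const (B n p q) + (- (Λ * CharacteristicPolynomial.identity ℚ.+-*-rawRing p q))

-- `b` is defined by cases, so it unfolds only once `n` is split. At size 0 the empty determinant is
-- `1#`, which agrees with the convention for `b zero`.
b≡det : ∀ n → b n ≡ Determinant.det ℚ[λ] (B-λI n)
b≡det zero    = ≡.refl
b≡det (suc n) = ≡.refl

-- `Λ * 0#` computes to a list of two zeros rather than to `[]`, hence the check coefficient by
-- coefficient.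
offDiagonal : ∀ a → const a + (- (Λ * 0#)) ≈ const a
offDiagonal a zero          = ℚₚ.+-identityʳ a
offDiagonal a (suc zero)    = ≡.refl
offDiagonal a (suc (suc k)) = ≡.refl

diagonal : const ℚ.0ℚ + (- (Λ * 1#)) ≈ - Λ
diagonal zero          = ≡.refl
diagonal (suc zero)    = ≡.refl
diagonal (suc (suc k)) = ≡.refl

B-λI-isUnitHessenbergToeplitz : IsUnitHessenbergToeplitz B-λI
B-λI-isUnitHessenbergToeplitz = record
  -- The comparisons and truncated subtractions in the entries cancel a common `suc` by computation.
  { toeplitz    = λ n i j k → ≡.refl
  ; subdiagonal = λ n → offDiagonal 1ℚ
  ; hessenberg  = λ n i → λ where
      zero          → ≡.refl
      (suc zero)    → ≡.refl
      (suc (suc k)) → ≡.refl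
  }

-- Uses that (-1)·2 = -2 and -1 = -¼·((-2)·(-2)) hold by evaluation in ℚ.
sign*2^ : ∀ k → (ℚ.- 1ℚ) ^ℚ suc k ℚ.* 2ℚ ^ℚ k ≡ ℚ.- ¼ ℚ.* -2ℚ ^ℚ (2 ℕ.+ k)
sign*2^ k = ≡R.begin
  ((ℚ.- 1ℚ) ℚ.* (ℚ.- 1ℚ) ^ℚ k) ℚ.* 2ℚ ^ℚ k   ≡R.≡⟨ ℚₚ.*-assoc (ℚ.- 1ℚ) ((ℚ.- 1ℚ) ^ℚ k) (2ℚ ^ℚ k) ⟩
  (ℚ.- 1ℚ) ℚ.* ((ℚ.- 1ℚ) ^ℚ k ℚ.* 2ℚ ^ℚ k)   ≡R.≡⟨ ≡.cong ((ℚ.- 1ℚ) ℚ.*_) (^-distrib-* (ℚ.- 1ℚ) 2ℚ k) ⟨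
  (ℚ.- ¼ ℚ.* (-2ℚ ℚ.* -2ℚ)) ℚ.* -2ℚ ^ℚ k     ≡R.≡⟨ ℚₚ.*-assoc (ℚ.- ¼) (-2ℚ ℚ.* -2ℚ) (-2ℚ ^ℚ k) ⟩
  ℚ.- ¼ ℚ.* ((-2ℚ ℚ.* -2ℚ) ℚ.* -2ℚ ^ℚ k)     ≡R.≡⟨ ≡.cong (ℚ.- ¼ ℚ.*_) (ℚₚ.*-assoc -2ℚ -2ℚ (-2ℚ ^ℚ k)) ⟩
  ℚ.- ¼ ℚ.* -2ℚ ^ℚ (2 ℕ.+ k)                 ≡R.∎
  where
  module ≡R = ≡.≡-Reasoning
  open Exp ℚRing.commutativeSemiring using (^-distrib-*)

-- This supplies the hypothesis of `det-recurrence` at column `suc k`, where the exponent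
-- `suc k ∸ 0 ∸ 1` is `k`. All factors are constants up to `≈`, and `- 1#` and `- const ¼` are
-- literally `const` of the negated numbers, so the claim descends to `sign*2^` in ℚ.
firstRow : ∀ k → (- 1#) ^ suc k * (const (2ℚ ^ℚ k) + (- (Λ * 0#))) ≈
                 (- const ¼) * const (-2ℚ ^ℚ (2 ℕ.+ k))
firstRow k = begin
  (- 1#) ^ suc k * (const (2ℚ ^ℚ k) + (- (Λ * 0#)))
    ≈⟨ *ₚ-congˡ ((- 1#) ^ suc k) (const (2ℚ ^ℚ k) + (- (Λ * 0#))) (const (2ℚ ^ℚ k)) (offDiagonal (2ℚ ^ℚ k)) ⟩
  (- 1#) ^ suc k * const (2ℚ ^ℚ k)
    ≈⟨ *ₚ-congʳ ((- 1#) ^ suc k) (const ((ℚ.- 1ℚ) ^ℚ suc k)) (const (2ℚ ^ℚ k)) (const-^ (ℚ.- 1ℚ) (suc k)) ⟩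
  const ((ℚ.- 1ℚ) ^ℚ suc k) * const (2ℚ ^ℚ k)
    ≈⟨ constant-homo-* ((ℚ.- 1ℚ) ^ℚ suc k) (2ℚ ^ℚ k) ⟩
  const ((ℚ.- 1ℚ) ^ℚ suc k ℚ.* 2ℚ ^ℚ k)
    ≡⟨ ≡.cong const (sign*2^ k) ⟩
  const (ℚ.- ¼ ℚ.* -2ℚ ^ℚ (2 ℕ.+ k))
    ≈⟨ constant-homo-* (ℚ.- ¼) (-2ℚ ^ℚ (2 ℕ.+ k)) ⟨
  (- const ¼) * const (-2ℚ ^ℚ (2 ℕ.+ k)) ∎

corollary7 : (n : ℕ) → n ≥ 1 →
    b n ≈ (- Λ) * b (n ∸ 1) - const ¼ * ∑⟨ 2 ⋯ n ⟩ (λ i → const (-2ℚ ^ℚ i) * b (n ∸ i))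
corollary7 (suc m) _ = begin
  b (suc m)
    -- Summation index `i` is `2 + k` for column `suc k`: the range from 2 to `suc m` has exactly
    -- `m` terms, and `suc m ∸ (2 + k)` computes to `m ∸ suc k`.
    ≈⟨ det-recurrence B-λI-isUnitHessenbergToeplitz m (- Λ) (const ¼) (λ k → const (-2ℚ ^ℚ (2 ℕ.+ k)))
         diagonal (λ q → firstRow (toℕ q)) ⟩
  (- Λ) * det (B-λI m) - const ¼ * ∑⟨ 2 ⋯ suc m ⟩ (λ i → const (-2ℚ ^ℚ i) * det (B-λI (suc m ∸ i)))
    -- Unlike `b (suc m)`, the smaller `b` terms do not unfold, since their index may be zero;
    -- `b≡det` rewrites each of them.
    ≡⟨ ≡.cong₂ (λ x y → (- Λ) * x - const ¼ * y) (b≡det m)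
         (sum-cong-≗ {m} λ q → ≡.cong (const (-2ℚ ^ℚ (2 ℕ.+ toℕ q)) *_) (b≡det (m ∸ suc (toℕ q)))) ⟨
  (- Λ) * b m - const ¼ * ∑⟨ 2 ⋯ suc m ⟩ (λ i → const (-2ℚ ^ℚ i) * b (suc m ∸ i)) ∎
  where
  open Determinant ℚ[λ] using (det)
  open SemiringSum (Ring.semiring polynomialRing) using (sum-cong-≗)
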